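{- Let $G_0$ be a bipartite PMH-graph admitting $t$ (distinct) vertices $u_1,\dots,u_t$ of degree $3$, for some $t\in\{1,\dots,|V(G_0)|\}$, and let $\mathcal{I}\subseteq\{i : \deg(u_i)=3\}$ (that is, $\mathcal{I}\subseteq\{1,\dots,t\}$). For each $i\in\mathcal{I}$, let $G_i$ be a bipartite graph admitting a 3-malleable vertex $v_i$. Then the bipartite graph obtained by applying a star product on $u_i$ and $v_i$, for each $i\in\mathcal{I}$, is PMH.
   Context: Graphs are finite and connected, may have multiple (parallel) edges, and have no loops; the degree of a vertex is the number of edges incident to it. A perfect matching is the edge set of a $1$-regular spanning subgraph, and a Hamiltonian cycle is a connected $2$-regular spanning subgraph. A Hamiltonian cycle $H$ extends a perfect matching $M$ if $M\subseteq E(H)$. A graph admitting a perfect matching is PMH if each of its perfect matchings can be extended to a Hamiltonian cycle. For a vertex $v$, $\partial v$ denotes the set of edges incident to $v$. If $G$ admits a perfect matching and $v$ is a vertex of degree $t\ge 2$, then $v$ is $t$-malleable if for every perfect matching $M$ of $G$ there exist Hamiltonian cycles $H_1,\dots,H_{t-1}$ of $G$, all extending $M$, such that $\partial v - M\subset \bigcup_{i=1}^{t-1}E(H_i)$. Star product: let $u\in V(G)$, $v\in V(G')$ be vertices of degree 3 in vertex-disjoint graphs, with incident edges $ua_1,ua_2,ua_3$ and $vb_1,vb_2,vb_3$ respectively. A star product on $u$ and $v$ is the graph $(G-u)\cup(G'-v)\cup\{a_1b_1,a_2b_2,a_3b_3\}$ (for any choice of the ordering of the neighbours). It is assumed that neither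 $G$ nor $G'$ is the cubic graph on two vertices (three parallel edges). Applying a star product on $u_i$ and $v_i$ for each $i\in\mathcal{I}$ means applying these star products successively: starting from $G_0$, for each $i\in\mathcal{I}$ in turn, apply a star product on the vertex corresponding to $u_i$ in the current graph and the vertex $v_i$ of $G_i$ (each with any choice of ordering of the neighbours). -}

module Defs where

open import Data.Bool.Base using (Bool; true; T)
open import Data.Bool.Properties using (T?)
open import Data.Fin.Base using (Fin)
import Data.Fin.Properties as Fin
open import Data.Fin.Subset using (Subset; _∈_; _∉_; _∪_; ⁅_⁆; ⊥)
open import Data.Irrelevant as Irrelevant using () renaming ([_] to irr)
open import Data.List.Base using (List; []; _∷_; _++_; map; filter; length; allFin)
import Data.List.Membership.Propositional as List
open import Data.List.Membership.Propositional.Properties using (∈-map⁺; ∈-map⁻; ∈-++⁺ˡ; ∈-++⁺ʳ; ∈-allFin)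
open import Data.List.Relation.Unary.All as All using (All; []; _∷_)
open import Data.List.Relation.Unary.AllPairs using ([]; _∷_)
open import Data.List.Relation.Unary.Any using (here; there)
open import Data.List.Relation.Unary.Enumerates.Setoid using (IsEnumeration)
open import Data.List.Relation.Unary.Unique.Propositional using (Unique)
open import Data.List.Relation.Unary.Unique.Propositional.Properties using (map⁺; ++⁺; allFin⁺)
open import Data.Maybe.Base using (Maybe; just; nothing)
open import Data.Nat.Base using (ℕ; _∸_; _≤_)
open import Data.Product.Base using (∃; _×_; _,_)
open import Data.Refinement.Base using (Refinement-syntax; value; _,_)
import Data.Refinement.Properties as Refinement
open import Data.Sum.Base using (_⊎_; inj₁; inj₂; [_,_]; [_,_]′)
open import Data.Sum.Properties using (≡-dec; inj₁-injective; inj₂-injective)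
open import Function.Base using (_∘_; const)
open import Function.Definitions using (Injective)
open import Relation.Binary.Construct.Closure.ReflexiveTransitive using (Star)
open import Relation.Binary.Definitions using (DecidableEquality)
open import Relation.Binary.PropositionalEquality using (_≡_; _≢_; refl; sym; trans; cong; setoid)
open import Relation.Nullary using (¬_; Dec; yes; no)
open import Relation.Nullary.Decidable using (_×-dec_; _⊎-dec_; ¬?)
open import Relation.Nullary.Negation using (contradiction-irr)
open import Relation.Unary using (Decidable)

------------------------------------------------------------------------
-- Finite types

record Finite (A : Set) : Set where
  infix 4 _≟_
  field
    elements : List A
    complete : IsEnumeration (setoid A) elements
    unique   : Unique elements
    _≟_      : DecidableEquality A

finFinite : ∀ n → Finite (Fin n)
finFinite n = record
  { elements = allFin n
  ; complete = ∈-allFin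
  ; unique   = allFin⁺ n
  ; _≟_      = Fin._≟_
  }

⊎-finite : ∀ {A B} → Finite A → Finite B → Finite (A ⊎ B)
⊎-finite FA FB = record
  { elements = map inj₁ A.elements ++ map inj₂ B.elements
  ; complete = [ ∈-++⁺ˡ ∘ ∈-map⁺ inj₁ ∘ A.complete
               , ∈-++⁺ʳ _ ∘ ∈-map⁺ inj₂ ∘ B.complete ]
  ; unique   = ++⁺ (map⁺ inj₁-injective A.unique)
                   (map⁺ inj₂-injective B.unique) disjoint
  ; _≟_      = ≡-dec A._≟_ B._≟_
  }
  where
  module A = Finite FA
  module B = Finite FB
  disjoint : ∀ {x} → ¬ (x List.∈ map inj₁ A.elements × x List.∈ map inj₂ B.elements)
  disjoint (p , q) with ∈-map⁻ inj₁ p | ∈-map⁻ inj₂ q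
  ... | _ , _ , refl | _ , _ , ()

module _ {A : Set} {P : A → Set} (P? : Decidable P) where

  refineList : List A → List [ x ∈ A ∣ P x ]
  refineList []       = []
  refineList (x ∷ xs) with P? x
  ... | yes p = (x , irr p) ∷ refineList xs
  ... | no  _ = refineList xs

  private
    refineList-complete : ∀ {xs} (y : [ x ∈ A ∣ P x ]) → value y List.∈ xs → y List.∈ refineList xs
    refineList-complete {x ∷ xs} (_ , irr p) (here refl) with P? x
    ... | yes _ = here refl
    ... | no ¬p = contradiction-irr p ¬p
    refineList-complete {x ∷ xs} y (there y∈xs) with P? x
    ... | yes _ = there (refineList-complete y y∈xs)
    ... | no  _ = refineList-complete y y∈xs

    refineList-≢ : ∀ {x xs} → All (x ≢_) xs → All (λ y → x ≢ value y) (refineList xs)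
    refineList-≢ [] = []
    refineList-≢ {xs = z ∷ _} (x≢z ∷ x≢zs) with P? z
    ... | yes _ = x≢z ∷ refineList-≢ x≢zs
    ... | no  _ = refineList-≢ x≢zs

    refineList-unique : ∀ {xs} → Unique xs → Unique (refineList xs)
    refineList-unique [] = []
    refineList-unique {x ∷ _} (x≢xs ∷ xs!) with P? x
    ... | yes _ = All.map (λ x≢y eq → x≢y (cong value eq)) (refineList-≢ x≢xs) ∷ refineList-unique xs!
    ... | no  _ = refineList-unique xs!

  refinement-finite : Finite A → Finite [ x ∈ A ∣ P x ]
  refinement-finite F = record
    { elements = refineList F.elements
    ; complete = λ y → refineList-complete y (F.complete (value y))
    ; unique   = refineList-unique F.unique
    ; _≟_      = Refinement._≟_ F._≟_
    }
    where module F = Finite F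

------------------------------------------------------------------------
-- Multigraphs

-- Edges are undirected: which endpoint is called `src` and which `tgt`
-- is an arbitrary choice that no definition below depends on.
-- Connectedness is a separate predicate.
record Multigraph : Set₁ where
  field
    V E      : Set
    V-finite : Finite V
    E-finite : Finite E
    src tgt  : E → V
    loopless : ∀ e → src e ≢ tgt e

module _ (G : Multigraph) where
  open Multigraph G
  private
    module FV = Finite V-finite
    module FE = Finite E-finite

  Incident : V → E → Set
  Incident x e = x ≡ src e ⊎ x ≡ tgt e

  incident? : ∀ x e → Dec (Incident x e)
  incident? x e = (x FV.≟ src e) ⊎-dec (x FV.≟ tgt e)

  Joins : E → V → V → Set
  Joins e x y = (x ≡ src e × y ≡ tgt e) ⊎ (x ≡ tgt e × y ≡ src e)

  order : ℕ
  order = length FV.elements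

  -- An edge set S is identified with the spanning subgraph (V, S).
  EdgeSet : Set
  EdgeSet = E → Bool

  degreeIn : EdgeSet → V → ℕ
  degreeIn S x = length (filter (λ e → T? (S e) ×-dec incident? x e) FE.elements)

  Regular : ℕ → EdgeSet → Set
  Regular k S = ∀ x → degreeIn S x ≡ k

  ConnectedIn : EdgeSet → Set
  ConnectedIn S = ∀ x y → Star (λ a b → ∃ λ e → T (S e) × Joins e a b) x y

  degree : V → ℕ
  degree = degreeIn (const true)

  Connected : Set
  Connected = ConnectedIn (const true)

  Bipartite : Set
  Bipartite = ∃ λ (colour : V → Bool) → ∀ e → colour (src e) ≢ colour (tgt e)

  IsPerfectMatching : EdgeSet → Set
  IsPerfectMatching M = Regular 1 M

  IsHamiltonianCycle : EdgeSet → Set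
  IsHamiltonianCycle H = Regular 2 H × ConnectedIn H

  Extends : EdgeSet → EdgeSet → Set
  Extends H M = ∀ e → T (M e) → T (H e)

  HasPerfectMatching : Set
  HasPerfectMatching = ∃ IsPerfectMatching

  PMH : Set
  PMH = HasPerfectMatching ×
    (∀ M → IsPerfectMatching M → ∃ λ H → IsHamiltonianCycle H × Extends H M)

  Malleable : ℕ → V → Set
  Malleable t v = HasPerfectMatching × 2 ≤ t × degree v ≡ t ×
    (∀ M → IsPerfectMatching M →
      ∃ λ (H : Fin (t ∸ 1) → EdgeSet) →
        (∀ i → IsHamiltonianCycle (H i) × Extends (H i) M) ×
        (∀ e → Incident v e → ¬ T (M e) → ∃ λ i → T (H i e)))

  -- The cubic graph on two vertices; being loopless, it consists of
  -- three parallel edges.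
  IsTheta : Set
  IsTheta = order ≡ 2 × Regular 3 (const true)

  -- An ordering of the edges at a vertex, which therefore has degree 3.
  record IncidentTriple (w : V) : Set where
    field
      edge      : Fin 3 → E
      injective : Injective _≡_ _≡_ edge
      incident  : ∀ i → Incident w (edge i)
      covers    : ∀ e → Incident w e → ∃ λ i → edge i ≡ e

  -- V(G − w) and E(G − w)
  VertexMinus : V → Set
  VertexMinus w = [ x ∈ V ∣ x ≢ w ]

  EdgeMinus : V → Set
  EdgeMinus w = [ e ∈ E ∣ ¬ Incident w e ]

  otherEnd : ∀ {w} e → Incident w e → VertexMinus w
  otherEnd e (inj₁ w≡src) = tgt e , irr (λ tgt≡w → loopless e (sym (trans tgt≡w w≡src)))
  otherEnd e (inj₂ w≡tgt) = src e , irr (λ src≡w → loopless e (trans src≡w w≡tgt))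

  srcMinus tgtMinus : ∀ {w} → EdgeMinus w → VertexMinus w
  srcMinus (e , ¬inc) = src e , Irrelevant.map (λ ¬p eq → ¬p (inj₁ (sym eq))) ¬inc
  tgtMinus (e , ¬inc) = tgt e , Irrelevant.map (λ ¬p eq → ¬p (inj₂ (sym eq))) ¬inc

  vertexMinus-finite : ∀ w → Finite (VertexMinus w)
  vertexMinus-finite w = refinement-finite (λ x → ¬? (x FV.≟ w)) V-finite

  edgeMinus-finite : ∀ w → Finite (EdgeMinus w)
  edgeMinus-finite w = refinement-finite (λ e → ¬? (incident? w e)) E-finite

------------------------------------------------------------------------
-- Star products

-- The edge inj₂ (inj₂ i) is the new edge aᵢbᵢ.
starProduct : (G : Multigraph) (u : Multigraph.V G) → IncidentTriple G u →
              (G′ : Multigraph) (v : Multigraph.V G′) → IncidentTriple G′ v →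
              Multigraph
starProduct G u α G′ v β = record
  { V        = VertexMinus G u ⊎ VertexMinus G′ v
  ; E        = EdgeMinus G u ⊎ (EdgeMinus G′ v ⊎ Fin 3)
  ; V-finite = ⊎-finite (vertexMinus-finite G u) (vertexMinus-finite G′ v)
  ; E-finite = ⊎-finite (edgeMinus-finite G u)
                        (⊎-finite (edgeMinus-finite G′ v) (finFinite 3))
  ; src      = [ inj₁ ∘ srcMinus G , [ inj₂ ∘ srcMinus G′ , inj₁ ∘ a ]′ ]′
  ; tgt      = [ inj₁ ∘ tgtMinus G , [ inj₂ ∘ tgtMinus G′ , inj₂ ∘ b ]′ ]′
  ; loopless = λ where
      (inj₁ e)        eq → Multigraph.loopless G  (value e) (cong value (inj₁-injective eq))
      (inj₂ (inj₁ e)) eq → Multigraph.loopless G′ (value e) (cong value (inj₂-injective eq))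
      (inj₂ (inj₂ i)) ()
  }
  where
  module α = IncidentTriple α
  module β = IncidentTriple β
  a : Fin 3 → VertexMinus G u
  a i = otherEnd G (α.edge i) (α.incident i)
  b : Fin 3 → VertexMinus G′ v
  b i = otherEnd G′ (β.edge i) (β.incident i)

module _ (G₀ : Multigraph) {t : ℕ} (u : Fin t → Multigraph.V G₀) {I : Subset t}
         (G : ∀ i → i ∈ I → Multigraph)
         (v : ∀ i (i∈I : i ∈ I) → Multigraph.V (G i i∈I)) where

  -- `StarProducts J H origin` says that H arises from G₀ by applying, in
  -- some order, one star product for each index in J.  The map `origin`
  -- sends a vertex of the current graph H to the vertex of G₀ it
  -- corresponds to, or to `nothing` if it comes from one of the Gᵢ.
  data StarProducts : Subset t → (H : Multigraph) →
                      (Multigraph.V H → Maybe (Multigraph.V G₀)) → Set₁ where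
    start : StarProducts ⊥ G₀ just
    apply : ∀ {J H origin} → StarProducts J H origin →
            ∀ i (i∈I : i ∈ I) → i ∉ J →
            (w : Multigraph.V H) → origin w ≡ just (u i) →
            ¬ IsTheta H → ¬ IsTheta (G i i∈I) →
            (α : IncidentTriple H w) (β : IncidentTriple (G i i∈I) (v i i∈I)) →
            StarProducts (J ∪ ⁅ i ⁆)
                         (starProduct H w α (G i i∈I) (v i i∈I) β)
                         [ origin ∘ value , const nothing ]′

  IsIteratedStarProduct : Multigraph → Set₁
  IsIteratedStarProduct H = ∃ λ origin → StarProducts I H origin

{-# OPTIONS --safe #-}

-- Let M be a perfect matching of the star product of G and G′ at u and v.  Contracting
-- either half to a vertex gives back G or G′, with M having degree 1 off the contracted
-- vertex; since a bipartite graph with a perfect matching is balanced, M is a perfect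
-- matching there too, so it uses exactly one of the three cut edges.
-- Extend M to a Hamiltonian cycle C of G, which crosses the cut once outside M;
-- malleability gives a Hamiltonian cycle D of G′ crossing at the same place, and
-- C and D glue to a Hamiltonian cycle of the product.  The glued edge set is
-- connected because C − u and D − v are: the M-alternating walk along C that starts
-- at u joins its two neighbours on C before it comes back to u.

module Submission where

open import Defs
open import Data.Bool.Base using (Bool; true; false; T; not; _∧_)
open import Data.Bool.Properties using (T?; ¬-not; not-¬; not-injective)
import Data.Bool.Properties as Bool
open import Data.Empty using (⊥-elim)
open import Data.Fin.Base using (Fin; toℕ)
open import Data.Fin.Properties using (pigeonhole)
open import Data.Fin.Subset using (Subset; _∈_)
open import Data.Irrelevant using () renaming ([_] to irr)
open import Data.List.Base using (List; []; _∷_; map; filter; length)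
import Data.List.Membership.Propositional as List
open import Data.List.Membership.Propositional.Properties using (∈-map⁺; ∈-map⁻; ∈-filter⁺; ∈-filter⁻)
open import Data.List.Membership.Propositional.Properties.WithK using (unique∧set⇒bag)
open import Data.List.Membership.Setoid.Properties using (index-injective)
open import Data.List.Properties using (length-map; filter-accept; filter-reject)
open import Data.List.Relation.Binary.BagAndSetEquality using (∼bag⇒↭)
open import Data.List.Relation.Binary.Permutation.Propositional.Properties using (↭-length)
open import Data.List.Relation.Unary.All using ([]; _∷_)
open import Data.List.Relation.Unary.AllPairs using ([]; _∷_)
open import Data.List.Relation.Unary.Any using (here; there; index)
open import Data.List.Relation.Unary.Unique.Propositional using (Unique)
open import Data.List.Relation.Unary.Unique.Propositional.Properties using (map⁺; filter⁺)
open import Data.Nat.Base using (ℕ; zero; suc; _+_; _≤_; _<_; s≤s)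
open import Data.Nat.GeneralisedArithmetic using (fold)
open import Data.Nat.Properties using (n<1+n; +-suc; +-cancelˡ-≡)
open import Data.Product.Base using (∃; _×_; _,_; proj₁; proj₂)
open import Data.Refinement.Base using (value; _,_)
open import Data.Refinement.Properties using (value-injective)
open import Data.Sum.Base using (_⊎_; inj₁; inj₂; [_,_]; [_,_]′)
open import Data.Sum.Properties using (inj₁-injective; inj₂-injective)
open import Function.Base using (_∘_; id)
open import Function.Bundles using (mk⇔)
open import Function.Definitions using (Injective)
open import Relation.Binary.Construct.Closure.ReflexiveTransitive using (Star; ε; _◅_; _◅◅_; reverse)
import Relation.Binary.Construct.Closure.ReflexiveTransitive as Star
open import Relation.Binary.PropositionalEquality using (_≡_; _≢_; refl; sym; trans; cong; subst; setoid)
open import Relation.Nullary using (¬_; Dec; yes; no)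
open import Relation.Nullary.Decidable using (_×-dec_)
open import Relation.Nullary.Negation using (contradiction; contradiction-irr)
open import Relation.Unary using (Decidable)
open Multigraph using (V; E)

-- Counting in lists, iterates of injections, and Boolean edge sets.

-- Lists without duplicates that have the same members are permutations of each other, so only
-- membership has to be compared.
length-≡ : ∀ {A B : Set} {g : A → B} {xs ys} → Injective _≡_ _≡_ g → Unique xs → Unique ys →
           (∀ {x} → x List.∈ xs → g x List.∈ ys) →
           (∀ {y} → y List.∈ ys → ∃ λ x → x List.∈ xs × y ≡ g x) →
           length xs ≡ length ys
length-≡ {g = g} {xs} {ys} g-inj xs! ys! to from =
  trans (sym (length-map g xs)) (↭-length (∼bag⇒↭ (unique∧set⇒bag (map⁺ g-inj xs!) ys! (mk⇔ to′ from′))))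
  where
  to′ : ∀ {y} → y List.∈ map g xs → y List.∈ ys
  to′ y∈ with ∈-map⁻ g y∈
  ... | x , x∈ , refl = to x∈
  from′ : ∀ {y} → y List.∈ ys → y List.∈ map g xs
  from′ y∈ with from y∈
  ... | x , x∈ , refl = ∈-map⁺ g x∈

length-filter-⊎ : ∀ {A : Set} {P Q R : A → Set}
                  (P? : Decidable P) (Q? : Decidable Q) (R? : Decidable R) →
                  (∀ {x} → P x → Q x ⊎ R x) → (∀ {x} → Q x → P x) → (∀ {x} → R x → P x) →
                  (∀ {x} → Q x → ¬ R x) → ∀ xs →
                  length (filter P? xs) ≡ length (filter Q? xs) + length (filter R? xs)
length-filter-⊎ P? Q? R? split Q⇒P R⇒P Q⇒¬R = go
  where
  go : ∀ xs → length (filter P? xs) ≡ length (filter Q? xs) + length (filter R? xs)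
  go []       = refl
  go (x ∷ xs) with Q? x | R? x
  ... | yes q | yes r = contradiction r (Q⇒¬R q)
  ... | yes q | no  _ rewrite filter-accept P? {xs = xs} (Q⇒P q) = cong suc (go xs)
  ... | no  _ | yes r rewrite filter-accept P? {xs = xs} (R⇒P r) =
    trans (cong suc (go xs)) (sym (+-suc _ _))
  ... | no ¬q | no ¬r rewrite filter-reject P? {xs = xs} ([ ¬q , ¬r ] ∘ split) = go xs

-- Among the first `length elements + 1` iterates of `x` two coincide; injectivity strips their
-- common steps until one of them is `x` itself.
returns : ∀ {A : Set} → Finite A → {f : A → A} → Injective _≡_ _≡_ f →
          ∀ x → ∃ λ n → fold x f (suc n) ≡ x
returns {A} FA {f} f-inj x =
  let i , j , i<j , eq = pigeonhole (n<1+n _) (position ∘ fold x f ∘ toℕ)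
  in cancel i<j (index-injective (setoid A) (complete _) (complete _) eq)
  where
  open Finite FA using (elements; complete)
  position : A → Fin (length elements)
  position = index ∘ complete
  cancel : ∀ {i j} → i < j → fold x f i ≡ fold x f j → ∃ λ n → fold x f (suc n) ≡ x
  cancel {zero}  {suc j} _         eq = j , sym eq
  cancel {suc i} {suc j} (s≤s i<j) eq = cancel i<j (f-inj eq)

≢-≢⇒≡ : ∀ {a b c : Bool} → a ≢ b → c ≢ b → a ≡ c
≢-≢⇒≡ p q = trans (¬-not p) (sym (¬-not q))

T-≡ : ∀ {a b} → (T a → T b) → (T b → T a) → a ≡ b
T-≡ {true}  {true}  _ _ = refl
T-≡ {true}  {false} f _ = ⊥-elim (f _)
T-≡ {false} {true}  _ f = ⊥-elim (f _)
T-≡ {false} {false} _ _ = refl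

infixl 6 _∖_
_∖_ : ∀ {A : Set} → (A → Bool) → (A → Bool) → A → Bool
(C ∖ M) e = C e ∧ not (M e)

module _ {A : Set} (C M : A → Bool) where

  ∖-in : ∀ e → T (C e) → ¬ T (M e) → T ((C ∖ M) e)
  ∖-in e c ¬m with C e | M e
  ... | true | true  = ¬m _
  ... | true | false = _

  ∖-⊆ : ∀ e → T ((C ∖ M) e) → T (C e)
  ∖-⊆ e t with C e
  ... | true = _

  ∖-∉ : ∀ e → T ((C ∖ M) e) → ¬ T (M e)
  ∖-∉ e t m with C e | M e
  ... | true | true = t

  split-∖ : ∀ e → T (C e) → T (M e) ⊎ T ((C ∖ M) e)
  split-∖ e c with C e | M e
  ... | true | true  = inj₁ _
  ... | true | false = inj₂ _

-- Degrees and perfect matchings.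

degree-transfer : ∀ {G G′ : Multigraph} {S : EdgeSet G} {S′ : EdgeSet G′} {x x′} (g : E G → E G′) →
                  Injective _≡_ _≡_ g →
                  (∀ {e} → T (S e) → Incident G x e → T (S′ (g e)) × Incident G′ x′ (g e)) →
                  (∀ {e′} → T (S′ e′) → Incident G′ x′ e′ →
                    ∃ λ e → T (S e) × Incident G x e × e′ ≡ g e) →
                  degreeIn G S x ≡ degreeIn G′ S′ x′
degree-transfer {G} {G′} {S} {S′} {x} {x′} g g-inj to from =
  length-≡ g-inj (filter⁺ P? (FE.unique)) (filter⁺ P′? FE′.unique)
    (λ e∈ → let _ , s , i = ∈-filter⁻ P? {xs = FE.elements} e∈ in ∈-filter⁺ P′? (FE′.complete _) (to s i))
    (λ e∈ → let _ , s , i = ∈-filter⁻ P′? {xs = FE′.elements} e∈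
                e , s , i , eq = from s i
            in e , ∈-filter⁺ P? (FE.complete _) (s , i) , eq)
  where
  module FE  = Finite (Multigraph.E-finite G)
  module FE′ = Finite (Multigraph.E-finite G′)
  P?  = λ e → T? (S e) ×-dec incident? G x e
  P′? = λ e → T? (S′ e) ×-dec incident? G′ x′ e

module _ (G : Multigraph) where
  private module FE = Finite (Multigraph.E-finite G)

  degree-cong : ∀ {S S′ : EdgeSet G} → (∀ e → S e ≡ S′ e) → ∀ x → degreeIn G S x ≡ degreeIn G S′ x
  degree-cong S≗S′ x = degree-transfer {G} {G} id id (λ s i → subst T (S≗S′ _) s , i)
    (λ s i → _ , subst T (sym (S≗S′ _)) s , i , refl)

  AtMostOneAt : EdgeSet G → V G → Set
  AtMostOneAt S x = ∀ {e e′} → T (S e) → Incident G x e → T (S e′) → Incident G x e′ → e ≡ e′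

  -- The three cases by which `degree-at-root` forces a degree to be 1. For excess degree, two
  -- distinct edges are all that the contradiction needs.
  data DegreeView (S : EdgeSet G) (x : V G) : Set where
    none : (∀ {e} → T (S e) → ¬ Incident G x e) → DegreeView S x
    one  : degreeIn G S x ≡ 1 → DegreeView S x
    many : ∀ {e e′} → e ≢ e′ → T (S e) → Incident G x e → T (S e′) → Incident G x e′ → DegreeView S x

  edge-at-one : ∀ {S x} → degreeIn G S x ≡ 1 →
                (∃ λ e → T (S e) × Incident G x e) × AtMostOneAt S x
  edge-at-one {S} {x} d = go _ refl d
    where
    P? = λ e → T? (S e) ×-dec incident? G x e
    go : ∀ es → filter P? FE.elements ≡ es → length es ≡ 1 →
         (∃ λ e → T (S e) × Incident G x e) × AtMostOneAt S x
    go (e ∷ []) eq _ = (e , proj₂ (∈-filter⁻ P? {xs = FE.elements} (subst (e List.∈_) (sym eq) (here refl)))) ,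
      λ s i s′ i′ → trans (only s i) (sym (only s′ i′))
      where
      only : ∀ {e′} → T (S e′) → Incident G x e′ → e′ ≡ e
      only s i with subst (_ List.∈_) eq (∈-filter⁺ P? (FE.complete _) (s , i))
      ... | here p = p

  degree-view : ∀ S x → DegreeView S x
  degree-view S x = go _ refl (filter⁺ P? FE.unique)
    where
    P? = λ e → T? (S e) ×-dec incident? G x e
    sound : ∀ {e es} → filter P? FE.elements ≡ es → e List.∈ es → T (S e) × Incident G x e
    sound refl e∈ = proj₂ (∈-filter⁻ P? {xs = FE.elements} e∈)
    go : ∀ es → filter P? FE.elements ≡ es → Unique es → DegreeView S x
    go []            eq _ = none λ s i → case-[] (subst (_ List.∈_) eq (∈-filter⁺ P? (FE.complete _) (s , i)))
      where
      case-[] : ∀ {e : E G} → ¬ (e List.∈ [])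
      case-[] ()
    go (_ ∷ [])      eq _ = one (cong length eq)
    go (e ∷ e′ ∷ _) eq ((e≢e′ ∷ _) ∷ _) =
      let s  , i  = sound eq (here refl)
          s′ , i′ = sound eq (there (here refl))
      in many e≢e′ s i s′ i′

  -- At each vertex, `C` has two edges and `M` takes one of them. A Hamiltonian cycle extending `M`
  -- thus splits into two perfect matchings, the form in which cycles are handled below.
  complement-matching : ∀ {C M} → Regular G 2 C → Extends G C M → IsPerfectMatching G M →
                        IsPerfectMatching G (C ∖ M)
  complement-matching {C} {M} C-reg M⊆C M-pm x =
    +-cancelˡ-≡ 1 _ _ (trans (cong (_+ degreeIn G (C ∖ M) x) (sym (M-pm x))) (trans (sym additive) (C-reg x)))
    where
    additive : degreeIn G C x ≡ degreeIn G M x + degreeIn G (C ∖ M) x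
    additive = length-filter-⊎ _ _ _
      (λ (c , i) → [ (λ m → inj₁ (m , i)) , (λ r → inj₂ (r , i)) ] (split-∖ C M _ c))
      (λ (m , i) → M⊆C _ m , i) (λ (r , i) → ∖-⊆ C M _ r , i)
      (λ (m , _) (r , _) → ∖-∉ C M _ r m) FE.elements


-- Alternating walks in bipartite graphs.

module _ (G : Multigraph) where
  private module FV = Finite (Multigraph.V-finite G)

  opposite : ∀ {x} e → Incident G x e → V G
  opposite e i = value (otherEnd G e i)

  joins-opposite : ∀ {x} e (i : Incident G x e) → Joins G e x (opposite e i)
  joins-opposite e (inj₁ p) = inj₁ (p , refl)
  joins-opposite e (inj₂ p) = inj₂ (p , refl)

  opposite-incident : ∀ {x} e (i : Incident G x e) → Incident G (opposite e i) e
  opposite-incident e (inj₁ _) = inj₂ refl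
  opposite-incident e (inj₂ _) = inj₁ refl

  joins⇒incidentˡ : ∀ {e x y} → Joins G e x y → Incident G x e
  joins⇒incidentˡ (inj₁ (p , _)) = inj₁ p
  joins⇒incidentˡ (inj₂ (p , _)) = inj₂ p

  joins-sym : ∀ {e x y} → Joins G e x y → Joins G e y x
  joins-sym (inj₁ (p , q)) = inj₂ (q , p)
  joins-sym (inj₂ (p , q)) = inj₁ (q , p)

  opposite-unique : ∀ {x y e} (i : Incident G x e) → Joins G e x y → y ≡ opposite e i
  opposite-unique (inj₁ _) (inj₁ (_ , q)) = q
  opposite-unique {e = e} (inj₁ p) (inj₂ (p′ , _)) =
    contradiction (trans (sym p) p′) (Multigraph.loopless G e)
  opposite-unique {e = e} (inj₂ p) (inj₁ (p′ , _)) =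
    contradiction (trans (sym p′) p) (Multigraph.loopless G e)
  opposite-unique (inj₂ _) (inj₂ (_ , q)) = q

  module TwoColoured (bipartite : Bipartite G) where
    colour : V G → Bool
    colour = proj₁ bipartite

    colour-joins : ∀ {e x y} → Joins G e x y → colour x ≢ colour y
    colour-joins {e} (inj₁ (refl , refl)) = proj₂ bipartite e
    colour-joins {e} (inj₂ (refl , refl)) = proj₂ bipartite e ∘ sym

    incident-same-colour : ∀ {e x y} → Incident G x e → Incident G y e → colour x ≡ colour y → x ≡ y
    incident-same-colour (inj₁ p) (inj₁ q) _ = trans p (sym q)
    incident-same-colour (inj₁ p) (inj₂ q) c = contradiction c (colour-joins (inj₁ (p , q)))
    incident-same-colour (inj₂ p) (inj₁ q) c = contradiction c (colour-joins (inj₂ (p , q)))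
    incident-same-colour (inj₂ p) (inj₂ q) _ = trans p (sym q)

    -- The successor map of an alternating walk: vertices of colour b leave along an
    -- R-edge, the others along their N-edge.  R-unique makes it injective, hence a
    -- permutation.
    module Alternating
      {N : EdgeSet G} (N-matching : IsPerfectMatching G N) (b : Bool) (R : V G → E G → Set)
      (R-edge : ∀ x → colour x ≡ b → ∃ λ e → R x e × Incident G x e)
      (R-unique : ∀ x x′ {y e e′} → colour y ≢ b → R x e → R x′ e′ →
                  Incident G y e → Incident G y e′ → e ≡ e′)
      where

      Chosen : V G → E G → Set
      Chosen x e = (colour x ≡ b × R x e) ⊎ (colour x ≢ b × T (N e))

      choose : ∀ x → ∃ λ e → Chosen x e × Incident G x e
      choose x with colour x Bool.≟ b
      ... | yes p = let e , r , i = R-edge x p in e , inj₁ (p , r) , i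
      ... | no ¬p = let e , n , i = proj₁ (edge-at-one G (N-matching x)) in e , inj₂ (¬p , n) , i

      next : V G → V G
      next x = let e , _ , i = choose x in opposite e i

      next-joins : ∀ x → Joins G (proj₁ (choose x)) x (next x)
      next-joins x = let e , _ , i = choose x in joins-opposite e i

      next-incident : ∀ x → Incident G (next x) (proj₁ (choose x))
      next-incident x = let e , _ , i = choose x in opposite-incident e i

      -- Vertices with a common successor have the same colour, so both leave along `R`-edges or
      -- both along `N`-edges. `R-unique` or the matching property then identifies the two edges,
      -- and an edge has only one end of each colour.
      next-injective : Injective _≡_ _≡_ next
      next-injective {x} {x′} eq =
        incident-same-colour (proj₂ (proj₂ (choose x)))
          (subst (Incident G x′) (sym edges≡) (proj₂ (proj₂ (choose x′)))) colours≡
        where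
        colours≡ : colour x ≡ colour x′
        colours≡ = ≢-≢⇒≡ (colour-joins (next-joins x))
          (subst (λ y → colour x′ ≢ colour y) (sym eq) (colour-joins (next-joins x′)))
        edges≡ : proj₁ (choose x) ≡ proj₁ (choose x′)
        edges≡ with proj₁ (proj₂ (choose x)) | proj₁ (proj₂ (choose x′))
                  | subst (λ y → Incident G y (proj₁ (choose x′))) (sym eq) (next-incident x′)
        ... | inj₁ (p , r) | inj₁ (_ , r′) | i′ =
          R-unique _ _ (λ q → colour-joins (next-joins x) (trans p (sym q))) r r′ (next-incident x) i′
        ... | inj₂ (_ , n) | inj₂ (_ , n′) | i′ =
          proj₂ (edge-at-one G (N-matching (next x))) n (next-incident x) n′ i′
        ... | inj₁ (p , _) | inj₂ (¬p , _) | _ = contradiction (trans (sym colours≡) p) ¬p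
        ... | inj₂ (¬p , _) | inj₁ (p , _) | _ = contradiction (trans colours≡ p) ¬p

      -- The walk from `z` returns to `z`. Its last step changes colour, hence starts at a vertex of
      -- colour `b` and runs along an `R`-edge. This plays the part of comparing the sizes of the
      -- two colour classes.
      R-saturates : ∀ z → colour z ≢ b →
                    ∃ λ x → ∃ λ e → colour x ≡ b × R x e × Incident G x e × Incident G z e
      R-saturates z cz≢b with returns (Multigraph.V-finite G) next-injective z
      ... | n , eq with choose (fold z next n) | next-joins (fold z next n) | next-incident (fold z next n)
      ... | e , inj₁ (p , r) , i | _ | j = _ , e , p , r , i , subst (λ y → Incident G y e) eq j
      ... | e , inj₂ (¬p , _) , _ | k | _ =
        contradiction (≢-≢⇒≡ {b = b} ¬p cz≢b)
          (subst (λ y → colour (fold z next n) ≢ colour y) eq (colour-joins k))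

    -- A bipartite graph with a perfect matching is balanced, so the last degree is forced.
    degree-at-root : HasPerfectMatching G → ∀ {S w} → (∀ x → x ≢ w → degreeIn G S x ≡ 1) →
                     degreeIn G S w ≡ 1
    degree-at-root (N , N-pm) {S} {w} d with degree-view G S w
    ... | one p  = p
    -- Were `w` without `S`-edges, the opposite class could still choose its `S`-edges as `R`, since
    -- no two of them meet in a vertex of the class of `w`. Saturation then gives `w` an `S`-edge
    -- after all.
    ... | none ∅ =
      let x , e , _ , s , _ , i = R-saturates w (not-¬ refl) in contradiction i (∅ s)
      where
      R : V G → E G → Set
      R _ e = T (S e)
      R-edge : ∀ x → colour x ≡ not (colour w) → ∃ λ e → R x e × Incident G x e
      R-edge x p = proj₁ (edge-at-one G (d x λ x≡w → not-¬ (cong colour x≡w) p))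
      R-unique : ∀ x x′ {y e e′} → colour y ≢ not (colour w) → R x e → R x′ e′ →
                 Incident G y e → Incident G y e′ → e ≡ e′
      R-unique _ _ {y} {e} _ s s′ i i′ =
        proj₂ (edge-at-one G (d y λ y≡w → ∅ s (subst (λ x → Incident G x e) y≡w i))) s i s′ i′
      open Alternating N-pm (not (colour w)) R R-edge R-unique
    -- Here `R` makes `w` choose `e₁`. The other end `z` of `e₂` is saturated by an `S`-edge, which
    -- can only be `e₂`, since `z` has degree 1 in `S`. The vertex that chose it has the colour of
    -- `w` and so is `w`, contradicting its choice of `e₁`.
    ... | many {e₁} {e₂} e₁≢e₂ s₁ i₁ s₂ i₂ =
      let x , e , p , (s , x≡w⇒) , i , j = R-saturates z (cw≢cz ∘ sym)
          e≡e₂ = proj₂ (edge-at-one G (d z (λ z≡w → cw≢cz (cong colour (sym z≡w)))))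
                   s j s₂ (opposite-incident e₂ i₂)
          x≡w = incident-same-colour (subst (Incident G x) e≡e₂ i) i₂ p
      in contradiction (trans (sym (x≡w⇒ x≡w)) e≡e₂) e₁≢e₂
      where
      z : V G
      z = opposite e₂ i₂
      cw≢cz : colour w ≢ colour z
      cw≢cz = colour-joins (joins-opposite e₂ i₂)
      R : V G → E G → Set
      R x e = T (S e) × (x ≡ w → e ≡ e₁)
      R-edge : ∀ x → colour x ≡ colour w → ∃ λ e → R x e × Incident G x e
      R-edge x _ with x FV.≟ w
      ... | yes refl = e₁ , (s₁ , λ _ → refl) , i₁
      ... | no x≢w   =
        let e , s , i = proj₁ (edge-at-one G (d x x≢w))
        in e , (s , λ x≡w → contradiction x≡w x≢w) , i
      R-unique : ∀ x x′ {y e e′} → colour y ≢ colour w → R x e → R x′ e′ →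
                 Incident G y e → Incident G y e′ → e ≡ e′
      R-unique _ _ {y} p (s , _) (s′ , _) i i′ = proj₂ (edge-at-one G (d y (p ∘ cong colour))) s i s′ i′
      open Alternating N-pm (colour w) R R-edge R-unique

    regular-everywhere : HasPerfectMatching G → ∀ {S w} → (∀ x → x ≢ w → degreeIn G S x ≡ 1) →
                         IsPerfectMatching G S
    regular-everywhere pm {S} {w} d x with x FV.≟ w
    ... | yes refl = degree-at-root pm d
    ... | no x≢w   = d x x≢w

    StepAvoiding : V G → EdgeSet G → V G → V G → Set
    StepAvoiding w C x y = x ≢ w × y ≢ w × ∃ λ e → T (C e) × Joins G e x y

    -- The alternating walk from w returns to w, necessarily along e′: after an
    -- even number of steps the next edge is in M, so it does not end in w.
    detour : ∀ {C M M′} → IsPerfectMatching G M → IsPerfectMatching G M′ →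
             (∀ e → T (M e) → T (C e)) → (∀ e → T (M′ e) → T (C e)) →
             ∀ {w e e′} → T (M e) → (i : Incident G w e) → T (M′ e′) → (i′ : Incident G w e′) →
             Star (StepAvoiding w C) (opposite e i) (opposite e′ i′)
    detour {C} {M} {M′} M-pm M′-pm M⊆C M′⊆C {w} {e} {e′} m i m′ i′ =
      let n , eq = returns (Multigraph.V-finite G) next-injective w
      in [ id , (λ (p , _) → contradiction eq p) ] (walk n)
      where
      R : V G → E G → Set
      R _ e = T (M′ e)
      R-edge : ∀ x → colour x ≡ not (colour w) → ∃ λ e → R x e × Incident G x e
      R-edge x _ = proj₁ (edge-at-one G (M′-pm x))
      R-unique : ∀ x x′ {y e e′} → colour y ≢ not (colour w) → R x e → R x′ e′ →
                 Incident G y e → Incident G y e′ → e ≡ e′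
      R-unique _ _ {y} _ s s′ i i′ = proj₂ (edge-at-one G (M′-pm y)) s i s′ i′
      -- With this colour `w` itself leaves along its `M`-edge `e`, while every step into `w` comes
      -- from the opposite class, along `M′`.
      open Alternating M-pm (not (colour w)) R R-edge R-unique
      chosen-C : ∀ x → T (C (proj₁ (choose x)))
      chosen-C x with choose x
      ... | _ , inj₁ (_ , r) , _ = M′⊆C _ r
      ... | _ , inj₂ (_ , n) , _ = M⊆C _ n
      next-w : next w ≡ opposite e i
      next-w with choose w
      ... | _ , inj₁ (p , _) , _ = contradiction p (not-¬ refl)
      ... | g , inj₂ (_ , n) , j with proj₂ (edge-at-one G (M-pm w)) n j m i
      ... | refl = opposite-unique i (joins-opposite _ j)
      last : ∀ x → next x ≡ w → x ≡ opposite e′ i′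
      last x eq with choose x | next-joins x
      ... | g , inj₂ (q , _) , _ | k = contradiction (¬-not (λ c → colour-joins k (trans c (cong colour (sym eq))))) q
      ... | g , inj₁ (_ , r) , j | k
        with proj₂ (edge-at-one G (M′-pm w)) r (subst (λ y → Incident G y g) eq (opposite-incident g j)) m′ i′
      ... | refl = opposite-unique i′ (joins-sym (subst (Joins G g x) eq k))
      -- Stage `n` concerns the vertex after `suc n` steps, so stage 0 is at `opposite e i`. At the
      -- `n` supplied by `returns` the second alternative is impossible.
      walk : ∀ n → Star (StepAvoiding w C) (opposite e i) (opposite e′ i′) ⊎
             (fold w next (suc n) ≢ w × Star (StepAvoiding w C) (opposite e i) (fold w next (suc n)))
      walk zero = inj₂ ((λ p → colour-joins (next-joins w) (cong colour (sym p))) ,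
                        subst (Star _ _) (sym next-w) ε)
      walk (suc n) with walk n
      ... | inj₁ done = inj₁ done
      ... | inj₂ (x≢w , path) with next (fold w next (suc n)) FV.≟ w
      ... | yes p = inj₁ (subst (Star _ _) (last _ p) path)
      ... | no ¬p = inj₂ (¬p , path ◅◅ (x≢w , ¬p , _ , chosen-C _ , next-joins _) ◅ ε)

-- The halves of a star product and the contraction of the other half.

-- One of the two halves of a star product P: the subgraph K − r of P together with the
-- cut.  Via `lift`, the edges of K at r are identified with the cut edges.
record Side (K : Multigraph) (r : V K) (τ : IncidentTriple K r) (P : Multigraph) : Set where
  open IncidentTriple τ
  field
    vertex          : VertexMinus K r → V P
    kept            : EdgeMinus K r → E P
    cut             : Fin 3 → E P
    kept-injective  : Injective _≡_ _≡_ kept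
    cut-injective   : Injective _≡_ _≡_ cut
    kept≢cut        : ∀ e i → kept e ≢ cut i
    kept-joins      : ∀ {x y} e → Joins K (value e) (value x) (value y) →
                      Joins P (kept e) (vertex x) (vertex y)
    kept-incident   : ∀ {x} e → Incident P (vertex x) (kept e) → Incident K (value x) (value e)
    cut-incident    : ∀ i → Incident P (vertex (otherEnd K (edge i) (incident i))) (cut i)
    cut-incident⁻   : ∀ {x} i → Incident P (vertex x) (cut i) → x ≡ otherEnd K (edge i) (incident i)
    incident-edges  : ∀ {x} e → Incident P (vertex x) e → (∃ λ e′ → e ≡ kept e′) ⊎ (∃ λ i → e ≡ cut i)

  lift? : ∀ e → Dec (Incident K r e) → E P
  lift? e (yes i) = cut (proj₁ (covers e i))
  lift? e (no ¬i) = kept (e , irr ¬i)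

  lift : E K → E P
  lift e = lift? e (incident? K r e)

  lift-kept : ∀ e → lift (value e) ≡ kept e
  lift-kept (e , irr ¬i) with incident? K r e
  ... | yes i = contradiction-irr ¬i (λ ¬j → ¬j i)
  ... | no _  = refl

  lift-edge : ∀ i → lift (edge i) ≡ cut i
  lift-edge i with incident? K r (edge i)
  ... | yes p = cong cut (injective (proj₂ (covers (edge i) p)))
  ... | no ¬p = contradiction (incident i) ¬p

  data LiftView : E K → Set where
    kept-edge : ∀ e → LiftView (value e)
    cut-edge  : ∀ i → LiftView (edge i)

  lift-view : ∀ e → LiftView e
  lift-view e with incident? K r e
  ... | yes p = subst LiftView (proj₂ (covers e p)) (cut-edge _)
  ... | no ¬p = kept-edge (e , irr ¬p)

  lift-injective : Injective _≡_ _≡_ lift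
  lift-injective {e} {e′} eq with lift-view e | lift-view e′
  ... | kept-edge f | kept-edge f′ =
    cong value (kept-injective (trans (sym (lift-kept f)) (trans eq (lift-kept f′))))
  ... | kept-edge f | cut-edge i =
    contradiction (trans (sym (lift-kept f)) (trans eq (lift-edge i))) (kept≢cut f i)
  ... | cut-edge i | kept-edge f =
    contradiction (trans (sym (lift-kept f)) (trans (sym eq) (lift-edge i))) (kept≢cut f i)
  ... | cut-edge i | cut-edge j =
    cong edge (cut-injective (trans (sym (lift-edge i)) (trans eq (lift-edge j))))

  lift-joins : ∀ {e} (x y : VertexMinus K r) → Joins K e (value x) (value y) →
               Joins P (lift e) (vertex x) (vertex y)
  lift-joins {e} x y j with lift-view e
  ... | kept-edge f = subst (λ e → Joins P e (vertex x) (vertex y)) (sym (lift-kept f)) (kept-joins f j)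
  lift-joins (x , irr x≢r) (y , irr y≢r) j | cut-edge i =
    -- An edge of the triple has `r` as an end, but `x` and `y` both avoid `r`. These inequalities
    -- are irrelevant, so they may only serve to refute the case.
    contradiction-irr {A = x ≢ r × y ≢ r} (x≢r , y≢r) (λ (p , q) → [ p , q ] (ends j (incident i)))
    where
    ends : ∀ {e} → Joins K e x y → Incident K r e → x ≡ r ⊎ y ≡ r
    ends (inj₁ (p , q)) (inj₁ s) = inj₁ (trans p (sym s))
    ends (inj₁ (p , q)) (inj₂ s) = inj₂ (trans q (sym s))
    ends (inj₂ (p , q)) (inj₁ s) = inj₂ (trans q (sym s))
    ends (inj₂ (p , q)) (inj₂ s) = inj₁ (trans p (sym s))

  neighbour : Fin 3 → VertexMinus K r
  neighbour i = otherEnd K (edge i) (incident i)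

  incident⇒neighbour : ∀ {i} x → Incident K (value x) (edge i) → x ≡ neighbour i
  incident⇒neighbour {i} (x , irr x≢r) = go (incident i)
    where
    go : ∀ {e} (p : Incident K r e) → Incident K x e → (x , irr x≢r) ≡ otherEnd K e p
    go (inj₁ p) (inj₁ q) = contradiction-irr x≢r (λ x≢r → x≢r (trans q (sym p)))
    go (inj₁ p) (inj₂ q) = value-injective q
    go (inj₂ p) (inj₁ q) = value-injective q
    go (inj₂ p) (inj₂ q) = contradiction-irr x≢r (λ x≢r → x≢r (trans q (sym p)))

  lift-incident : ∀ {e} x → Incident K (value x) e → Incident P (vertex x) (lift e)
  lift-incident {e} x i with lift-view e
  ... | cut-edge j with refl ← incident⇒neighbour x i =
    subst (Incident P (vertex x)) (sym (lift-edge j)) (cut-incident j)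
  lift-incident x i | kept-edge f@(_ , irr ¬inc) =
    joins⇒incidentˡ P (lift-joins x
      (opposite K _ i , irr λ y≡r → ¬inc (subst (λ y → Incident K y _) y≡r (opposite-incident K _ i)))
      (joins-opposite K _ i))

  lift-incident⁻ : ∀ {e′} x → Incident P (vertex x) e′ → ∃ λ e → Incident K (value x) e × e′ ≡ lift e
  lift-incident⁻ x i with incident-edges _ i
  ... | inj₁ (f , refl) = value f , kept-incident f i , sym (lift-kept f)
  ... | inj₂ (j , refl) with refl ← cut-incident⁻ j i =
    edge j , opposite-incident K (edge j) (incident j) , sym (lift-edge j)

  -- Contracting the other half leaves incidences off `r` intact: `lift` maps the edges at `value x`
  -- bijectively to those at `vertex x`. Edge sets of `P` can therefore be studied in `K` as
  -- `S ∘ lift`.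
  degree-lift : ∀ S x → degreeIn K (S ∘ lift) (value x) ≡ degreeIn P S (vertex x)
  degree-lift S x = degree-transfer {K} {P} lift lift-injective
    (λ s i → s , lift-incident x i)
    (λ s i → let e , j , eq = lift-incident⁻ x i in e , subst (T ∘ S) eq s , j , eq)

  module _ (bipartite : Bipartite K) {C M : EdgeSet K} {S : EdgeSet P} (S-lift : ∀ e → S (lift e) ≡ C e)
    (C-ham : IsHamiltonianCycle K C) (M-pm : IsPerfectMatching K M) (M⊆C : Extends K C M)
    {j k} (j∈M : T (M (edge j))) (k∈C : T (C (edge k))) (k∉M : ¬ T (M (edge k))) where
    open TwoColoured K bipartite

    private
      _↝_ : V P → V P → Set
      _↝_ = Star (λ a b → ∃ λ e → T (S e) × Joins P e a b)

      M′ : EdgeSet K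
      M′ = C ∖ M

      M′-pm : IsPerfectMatching K M′
      M′-pm = complement-matching K (proj₁ C-ham) M⊆C M-pm

      k∈M′ : T (M′ (edge k))
      k∈M′ = ∖-in C M _ k∈C k∉M

    lift-step : ∀ {e} x y → T (C e) → Joins K e (value x) (value y) → vertex x ↝ vertex y
    lift-step {e} x y c p = (lift e , subst T (sym (S-lift e)) c , lift-joins x y p) ◅ ε

    lift-path : ∀ {x y} → Star (StepAvoiding r C) (value x) (value y) → vertex x ↝ vertex y
    lift-path {x} {y} p = go p x y refl refl
      where
      go : ∀ {a b} → Star (StepAvoiding r C) a b → ∀ x y → a ≡ value x → b ≡ value y → vertex x ↝ vertex y
      go ε x y refl q = subst (λ z → vertex x ↝ vertex z) (value-injective q) ε
      go ((_ , b≢r , _ , c , joins) ◅ p) x y refl q = lift-step x (_ , irr b≢r) c joins ◅◅ go p _ y refl q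

    -- The path `C - r`, obtained by alternating between the matchings `M` and `C ∖ M`, whose edges
    -- at `r` are those of index `j` and `k`.
    around : vertex (neighbour j) ↝ vertex (neighbour k)
    around = lift-path (detour M-pm M′-pm M⊆C (∖-⊆ C M) j∈M (incident j) k∈M′ (incident k))

    -- A walk in `C` towards `r` is lifted until it first enters `r`. It does so from neighbour `j`,
    -- the goal, or from neighbour `k`, whence `around` leads back to `j` within this half.
    reach : ∀ x → vertex x ↝ vertex (neighbour j)
    reach x = go (proj₂ C-ham (value x) r) x refl
      where
      back : vertex (neighbour k) ↝ vertex (neighbour j)
      back = reverse (λ (e , s , p) → e , s , joins-sym P p) around

      leave : ∀ {e} x → T (C e) → Joins K e (value x) r → vertex x ↝ vertex (neighbour j)
      leave {e} x c p with split-∖ C M e c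
      ... | inj₁ m with refl ← proj₂ (edge-at-one K (M-pm r)) m (joins⇒incidentˡ K (joins-sym K p)) j∈M (incident j)
        = subst (λ z → vertex x ↝ vertex z) (incident⇒neighbour x (joins⇒incidentˡ K p)) ε
      ... | inj₂ m with refl ← proj₂ (edge-at-one K (M′-pm r)) m (joins⇒incidentˡ K (joins-sym K p)) k∈M′ (incident k)
        = subst (λ z → vertex z ↝ vertex (neighbour j)) (sym (incident⇒neighbour x (joins⇒incidentˡ K p))) back

      go : ∀ {a} → Star (λ a b → ∃ λ e → T (C e) × Joins K e a b) a r → ∀ x → a ≡ value x →
           vertex x ↝ vertex (neighbour j)
      go ε (x , irr x≢r) p = contradiction-irr x≢r (λ x≢r → x≢r (sym p))
      go (_◅_ {j = y} (e , c , p) path) x refl with Finite._≟_ (Multigraph.V-finite K) y r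
      ... | yes refl = leave x c p
      ... | no y≢r   = lift-step x (y , irr y≢r) c p ◅◅ go path (y , irr y≢r) refl

-- Edges of matchings and cycles at a triple; connectedness and recolouring.

-- A perfect matching contains exactly one edge of a triple, so one common index fixes both
-- matchings on all three.
matchings-agree : ∀ {K L : Multigraph} {r s} (σ : IncidentTriple K r) (τ : IncidentTriple L s)
  {M : EdgeSet K} {N : EdgeSet L} →
  let module σ = IncidentTriple σ ; module τ = IncidentTriple τ in
  IsPerfectMatching K M → IsPerfectMatching L N → ∀ {i} → T (M (σ.edge i)) → T (N (τ.edge i)) →
  ∀ k → M (σ.edge k) ≡ N (τ.edge k)
matchings-agree {K} {L} {r} {s} σ τ {M} {N} M-pm N-pm {i} m n k = T-≡
  (λ m′ → subst (T ∘ N ∘ τ.edge) (σ.injective (proj₂ (edge-at-one K (M-pm r)) m (σ.incident i) m′ (σ.incident k))) n)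
  (λ n′ → subst (T ∘ M ∘ σ.edge) (τ.injective (proj₂ (edge-at-one L (N-pm s)) n (τ.incident i) n′ (τ.incident k))) m)
  where
  module σ = IncidentTriple σ
  module τ = IncidentTriple τ

matched-index : ∀ {K : Multigraph} {r} (τ : IncidentTriple K r) {M : EdgeSet K} → IsPerfectMatching K M →
                ∃ λ i → T (M (IncidentTriple.edge τ i))
matched-index {K} {r} τ {M} M-pm =
  let (e , m , i) , _ = edge-at-one K (M-pm r)
      j , eq = IncidentTriple.covers τ e i
  in j , subst (T ∘ M) (sym eq) m

unmatched-index : ∀ {K : Multigraph} {r} (τ : IncidentTriple K r) {C M : EdgeSet K} →
                  IsHamiltonianCycle K C → Extends K C M → IsPerfectMatching K M →
                  ∃ λ i → T (C (IncidentTriple.edge τ i)) × ¬ T (M (IncidentTriple.edge τ i))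
unmatched-index {K} τ {C} {M} (C-reg , _) M⊆C M-pm =
  let i , n = matched-index τ {C ∖ M} (complement-matching K C-reg M⊆C M-pm)
  in i , ∖-⊆ C M _ n , ∖-∉ C M _ n

-- Any Hamiltonian cycle is a connected spanning subgraph, and extending some perfect matching
-- provides one.
PMH⇒connected : ∀ {K} → PMH K → Connected K
PMH⇒connected ((M , M-pm) , extend) x y =
  let _ , (_ , connected) , _ = extend M M-pm
  in Star.map (λ (e , _ , p) → e , _ , p) (connected x y)

recolour : ∀ {K} → Bipartite K → ∀ x b → ∃ λ (bipartite : Bipartite K) → proj₁ bipartite x ≢ b
recolour (c , proper) x b with c x Bool.≟ b
... | no cx≢b = (c , proper) , cx≢b
... | yes refl = (not ∘ c , λ e → proper e ∘ not-injective) , not-¬ refl ∘ sym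

-- A single star product.

module StarProductPMH
  (H : Multigraph) (w : V H) (α : IncidentTriple H w)
  (G : Multigraph) (v : V G) (β : IncidentTriple G v)
  where

  private
    P : Multigraph
    P = starProduct H w α G v β
    module α = IncidentTriple α
    module β = IncidentTriple β

  left : Side H w α P
  left = record
    { vertex = inj₁
    ; kept   = inj₁
    ; cut    = inj₂ ∘ inj₂
    ; kept-injective = inj₁-injective
    ; cut-injective  = inj₂-injective ∘ inj₂-injective
    ; kept≢cut       = λ _ _ ()
    ; kept-joins     = λ where
        _ (inj₁ (p , q)) → inj₁ (cong inj₁ (value-injective p) , cong inj₁ (value-injective q))
        _ (inj₂ (p , q)) → inj₂ (cong inj₁ (value-injective p) , cong inj₁ (value-injective q))
    ; kept-incident  = λ where
        _ (inj₁ p) → inj₁ (cong value (inj₁-injective p))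
        _ (inj₂ p) → inj₂ (cong value (inj₁-injective p))
    ; cut-incident   = λ _ → inj₁ refl
    ; cut-incident⁻  = λ where
        _ (inj₁ p) → inj₁-injective p
        _ (inj₂ ())
    ; incident-edges = λ where
        (inj₁ e)        _ → inj₁ (e , refl)
        (inj₂ (inj₁ e)) (inj₁ ())
        (inj₂ (inj₁ e)) (inj₂ ())
        (inj₂ (inj₂ i)) _ → inj₂ (i , refl)
    }

  right : Side G v β P
  right = record
    { vertex = inj₂
    ; kept   = inj₂ ∘ inj₁
    ; cut    = inj₂ ∘ inj₂
    ; kept-injective = inj₁-injective ∘ inj₂-injective
    ; cut-injective  = inj₂-injective ∘ inj₂-injective
    ; kept≢cut       = λ _ _ ()
    ; kept-joins     = λ where
        _ (inj₁ (p , q)) → inj₁ (cong inj₂ (value-injective p) , cong inj₂ (value-injective q))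
        _ (inj₂ (p , q)) → inj₂ (cong inj₂ (value-injective p) , cong inj₂ (value-injective q))
    ; kept-incident  = λ where
        _ (inj₁ p) → inj₁ (cong value (inj₂-injective p))
        _ (inj₂ p) → inj₂ (cong value (inj₂-injective p))
    ; cut-incident   = λ _ → inj₂ refl
    ; cut-incident⁻  = λ where
        _ (inj₂ p) → inj₂-injective p
        _ (inj₁ ())
    ; incident-edges = λ where
        (inj₁ e)        (inj₁ ())
        (inj₁ e)        (inj₂ ())
        (inj₂ (inj₁ e)) _ → inj₁ (e , refl)
        (inj₂ (inj₂ i)) _ → inj₂ (i , refl)
    }

  private
    module L = Side left
    module R = Side right

  -- The cut edges are read off `C`; under the hypothesis `agree` of `Glue`, reading them off `D`
  -- gives the same set.
  glue : EdgeSet H → EdgeSet G → EdgeSet P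
  glue C D = [ C ∘ value , [ D ∘ value , C ∘ α.edge ]′ ]′

  module Glue {C : EdgeSet H} {D : EdgeSet G} (agree : ∀ i → C (α.edge i) ≡ D (β.edge i)) where

    glue-left : ∀ e → glue C D (L.lift e) ≡ C e
    glue-left e with L.lift-view e
    ... | L.kept-edge f = cong (glue C D) (L.lift-kept f)
    ... | L.cut-edge i  = cong (glue C D) (L.lift-edge i)

    glue-right : ∀ e → glue C D (R.lift e) ≡ D e
    glue-right e with R.lift-view e
    ... | R.kept-edge f = cong (glue C D) (R.lift-kept f)
    ... | R.cut-edge i  = trans (cong (glue C D) (R.lift-edge i)) (agree i)

    -- Used with degree 1 to glue perfect matchings and with degree 2 to glue Hamiltonian cycles.
    glue-regular : ∀ {k} → Regular H k C → Regular G k D → Regular P k (glue C D)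
    glue-regular C-reg D-reg (inj₁ x) =
      trans (sym (L.degree-lift (glue C D) x)) (trans (degree-cong H glue-left (value x)) (C-reg (value x)))
    glue-regular C-reg D-reg (inj₂ x) =
      trans (sym (R.degree-lift (glue C D) x)) (trans (degree-cong G glue-right (value x)) (D-reg (value x)))

    glue-extends : ∀ {M} → Extends H C (M ∘ L.lift) → Extends G D (M ∘ R.lift) → Extends P (glue C D) M
    glue-extends {M} C⊇ D⊇ (inj₁ e)        m = C⊇ (value e) (subst (T ∘ M) (sym (L.lift-kept e)) m)
    glue-extends {M} C⊇ D⊇ (inj₂ (inj₁ e)) m = D⊇ (value e) (subst (T ∘ M) (sym (R.lift-kept e)) m)
    glue-extends {M} C⊇ D⊇ (inj₂ (inj₂ i)) m = C⊇ (α.edge i) (subst (T ∘ M) (sym (L.lift-edge i)) m)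

  -- Once `v` is coloured differently from `w`, a neighbour of `w` and a neighbour of `v` also
  -- differ in colour, so the new edges are properly coloured.
  bipartite : Bipartite H → Bipartite G → Bipartite P
  bipartite H-bip@(c , c-proper) G-bip with recolour {G} G-bip v (c w)
  ... | G-bip′@(d , d-proper) , dv≢cw = [ c ∘ value , d ∘ value ] , λ where
      (inj₁ e)        → c-proper (value e)
      (inj₂ (inj₁ e)) → d-proper (value e)
      (inj₂ (inj₂ i)) eq → dv≢cw (sym (≢-≢⇒≡
        (H-coloured.colour-joins (joins-opposite H (α.edge i) (α.incident i)))
        (subst (d v ≢_) (sym eq) (G-coloured.colour-joins (joins-opposite G (β.edge i) (β.incident i))))))
    where
    module H-coloured = TwoColoured H H-bip
    module G-coloured = TwoColoured G G-bip′

  glue-hamiltonian : Bipartite H → Bipartite G → ∀ {C D M} →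
    IsHamiltonianCycle H C → IsHamiltonianCycle G D →
    IsPerfectMatching H (M ∘ L.lift) → IsPerfectMatching G (M ∘ R.lift) →
    Extends H C (M ∘ L.lift) → Extends G D (M ∘ R.lift) →
    (∀ i → M (L.lift (α.edge i)) ≡ M (R.lift (β.edge i))) →
    ∀ k → T (C (α.edge k)) → T (D (β.edge k)) → ¬ T (M (L.lift (α.edge k))) →
    IsHamiltonianCycle P (glue C D) × Extends P (glue C D) M
  glue-hamiltonian H-bip G-bip {C} {D} {M} (C-reg , C-connected) (D-reg , D-connected)
              M₁-pm M₂-pm M₁⊆C M₂⊆D M-agree k k∈C k∈D k∉M₁ =
    (Glue.glue-regular agree C-reg D-reg , connected) , Glue.glue-extends agree {M} M₁⊆C M₂⊆D
    where
    M₁ N₁ : EdgeSet H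
    M₁ = M ∘ L.lift
    N₁ = C ∖ M₁
    M₂ N₂ : EdgeSet G
    M₂ = M ∘ R.lift
    N₂ = D ∖ M₂

    k∉M₂ : ¬ T (M₂ (β.edge k))
    k∉M₂ = k∉M₁ ∘ subst T (sym (M-agree k))

    -- Each cycle is its restriction of `M` together with the complementary matching. The
    -- restrictions agree on the cut because both come from `M`, the complements because both
    -- contain index `k`.
    agree : ∀ i → C (α.edge i) ≡ D (β.edge i)
    agree i = T-≡
      (λ c → [ (λ m → M₂⊆D _ (subst T (M-agree i) m)) , (λ n → ∖-⊆ D M₂ _ (subst T (N-agree i) n)) ]
             (split-∖ C M₁ _ c))
      (λ d → [ (λ m → M₁⊆C _ (subst T (sym (M-agree i)) m))
             , (λ n → ∖-⊆ C M₁ _ (subst T (sym (N-agree i)) n)) ]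
             (split-∖ D M₂ _ d))
      where
      N-agree : ∀ i → N₁ (α.edge i) ≡ N₂ (β.edge i)
      N-agree = matchings-agree α β {N₁} {N₂}
        (complement-matching H C-reg M₁⊆C M₁-pm) (complement-matching G D-reg M₂⊆D M₂-pm)
        (∖-in C M₁ _ k∈C k∉M₁) (∖-in D M₂ _ k∈D k∉M₂)

    j : Fin 3
    j = proj₁ (matched-index α {M₁} M₁-pm)
    j∈M₁ : T (M₁ (α.edge j))
    j∈M₁ = proj₂ (matched-index α {M₁} M₁-pm)

    _↝_ : V P → V P → Set
    _↝_ = Star (λ a b → ∃ λ e → T (glue C D e) × Joins P e a b)

    -- All vertices are led to one end of the cut edge of `M`; those on the left reach its other end
    -- first and cross here.
    bridge : inj₁ (L.neighbour j) ↝ inj₂ (R.neighbour j)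
    bridge = (inj₂ (inj₂ j) , M₁⊆C _ j∈M₁ , inj₁ (refl , refl)) ◅ ε

    toBridge : ∀ x → x ↝ inj₂ (R.neighbour j)
    toBridge (inj₁ x) =
      L.reach H-bip {C} {M₁} {glue C D} (Glue.glue-left agree) (C-reg , C-connected)
        M₁-pm M₁⊆C j∈M₁ k∈C k∉M₁ x ◅◅ bridge
    toBridge (inj₂ x) =
      R.reach G-bip {D} {M₂} {glue C D} (Glue.glue-right agree) (D-reg , D-connected)
        M₂-pm M₂⊆D (subst T (M-agree j) j∈M₁) k∈D k∉M₂ x

    connected : ConnectedIn P (glue C D)
    connected x y = toBridge x ◅◅ reverse (λ (e , s , p) → e , s , joins-sym P {e} p) (toBridge y)

  module _ (H-bip : Bipartite H) (H-pmh : PMH H) (G-bip : Bipartite G) (v-malleable : Malleable G 3 v) where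

    -- The two cycles given by malleability cover all edges at `v` outside `M`, so one of them
    -- contains the prescribed edge.
    cycle-through : ∀ {M} → IsPerfectMatching G M → ∀ i → ¬ T (M (β.edge i)) →
                    ∃ λ D → IsHamiltonianCycle G D × Extends G D M × T (D (β.edge i))
    cycle-through {M} M-pm i ¬m =
      let _ , _ , _ , extend = v-malleable
          D , ham , cover = extend M M-pm
          n , d = cover (β.edge i) (β.incident i) ¬m
      in D n , proj₁ (ham n) , proj₂ (ham n) , d

    -- If the given matching misses the edge, a Hamiltonian cycle extending it passes through the
    -- edge, and the other half of that cycle is a suitable matching. This lets `G` follow whichever
    -- cut edge a matching of `H` uses.
    matching-through : ∀ i → ∃ λ M → IsPerfectMatching G M × T (M (β.edge i))
    matching-through i with proj₁ v-malleable
    ... | M , M-pm with T? (M (β.edge i))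
    ... | yes m = M , M-pm , m
    ... | no ¬m =
      let D , (D-reg , _) , M⊆D , d = cycle-through M-pm i ¬m
      in D ∖ M , complement-matching G D-reg M⊆D M-pm , ∖-in D M _ d ¬m

    hasPerfectMatching : HasPerfectMatching P
    hasPerfectMatching =
      let N , N-pm = proj₁ H-pmh
          i , n = matched-index α N-pm
          M , M-pm , m = matching-through i
      in glue N M , Glue.glue-regular (matchings-agree α β N-pm M-pm n m) N-pm M-pm

    extension : ∀ M → IsPerfectMatching P M → ∃ λ S → IsHamiltonianCycle P S × Extends P S M
    extension M M-pm =
      -- `C` comes first, with no control over its second edge `k` at `w`; malleability then lets
      -- `D` follow that choice.
      let C , C-ham , M₁⊆C = proj₂ H-pmh M₁ M₁-pm
          k , k∈C , k∉M₁   = unmatched-index α {C} C-ham M₁⊆C M₁-pm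
          k∉M₂             = λ m → k∉M₁ (subst T (sym (M-agree k)) m)
          D , D-ham , M₂⊆D , k∈D = cycle-through M₂-pm k k∉M₂
      in glue C D , glue-hamiltonian H-bip G-bip {C} {D} {M} C-ham D-ham M₁-pm M₂-pm M₁⊆C M₂⊆D M-agree k k∈C k∈D k∉M₁
      where
      M₁ : EdgeSet H
      M₁ = M ∘ L.lift
      M₂ : EdgeSet G
      M₂ = M ∘ R.lift

      M₁-pm : IsPerfectMatching H M₁
      -- Off `w` the degrees are those of `M` in `P`. At `w` the degree counts the cut edges in `M`,
      -- and balance forces it to be 1.
      M₁-pm = TwoColoured.regular-everywhere H H-bip (proj₁ H-pmh) λ x x≢w →
        trans (L.degree-lift M (x , irr x≢w)) (M-pm _)
      M₂-pm : IsPerfectMatching G M₂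
      M₂-pm = TwoColoured.regular-everywhere G G-bip (proj₁ v-malleable) λ x x≢v →
        trans (R.degree-lift M (x , irr x≢v)) (M-pm _)

      M-agree : ∀ i → M₁ (α.edge i) ≡ M₂ (β.edge i)
      M-agree i = cong M (trans (L.lift-edge i) (sym (R.lift-edge i)))

    pmh : PMH P
    pmh = hasPerfectMatching , extension

-- Iterated star products.

-- Induction over the successive products. Bipartiteness is carried along with the PMH property
-- because the balance argument at the next product relies on it.
starProducts-PMH : ∀ {G₀ t} {u : Fin t → V G₀} {I} {G : ∀ i → i ∈ I → Multigraph}
                   {v : ∀ i (i∈I : i ∈ I) → V (G i i∈I)} →
                   Bipartite G₀ → PMH G₀ →
                   (∀ i i∈I → Bipartite (G i i∈I)) → (∀ i i∈I → Malleable (G i i∈I) 3 (v i i∈I)) →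
                   ∀ {J H origin} → StarProducts G₀ u G v J H origin → Bipartite H × PMH H
starProducts-PMH G₀-bip G₀-pmh G-bip v-mal start = G₀-bip , G₀-pmh
starProducts-PMH G₀-bip G₀-pmh G-bip v-mal (apply {H = H} s i i∈I _ w _ _ _ α β) =
  let H-bip , H-pmh = starProducts-PMH G₀-bip G₀-pmh G-bip v-mal s
  in StarProductPMH.bipartite H w α _ _ β H-bip (G-bip i i∈I) ,
     StarProductPMH.pmh H w α _ _ β H-bip H-pmh (G-bip i i∈I) (v-mal i i∈I)

theorem3p6 : (G₀ : Multigraph) → Connected G₀ → Bipartite G₀ → PMH G₀ →
    (t : ℕ) → 1 ≤ t → t ≤ order G₀ →
    (u : Fin t → V G₀) → Injective _≡_ _≡_ u → (∀ i → degree G₀ (u i) ≡ 3) →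
    (I : Subset t) →
    (G : ∀ i → i ∈ I → Multigraph) →
    (∀ i (i∈I : i ∈ I) → Connected (G i i∈I) × Bipartite (G i i∈I)) →
    (v : ∀ i (i∈I : i ∈ I) → V (G i i∈I)) →
    (∀ i (i∈I : i ∈ I) → Malleable (G i i∈I) 3 (v i i∈I)) →
    (H : Multigraph) → IsIteratedStarProduct G₀ u G v H →
    Connected H × Bipartite H × PMH H
theorem3p6 G₀ _ G₀-bip G₀-pmh _ _ _ u _ _ I G G-good v v-mal H (_ , s) =
  let H-bip , H-pmh = starProducts-PMH G₀-bip G₀-pmh (λ i i∈I → proj₂ (G-good i i∈I)) v-mal s
  in PMH⇒connected {H} H-pmh , H-bip , H-pmh
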